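{- Let $V$ be a quasivariety and $X\in V$. If $X$ is recursively discriminable, then $\overline{X}\le_e X$, where $\overline{X}=I\setminus X$.
   Context: $I$ is a computable countable set identified with $\mathbb{N}$. A quasivariety $V$ is given by a recursively enumerable set $S$ of finite sequences $(n_0,\dots,n_k)$ of elements of $I$: $V$ is the set of all $X\subseteq I$ such that for every $(n_0,\dots,n_k)\in S$, if $n_1,\dots,n_k\in X$ then $n_0\in X$. Elements of $V$ are points. A set $Y\subseteq I$ is a discriminator for a point $X$ if $Y\cap X=\emptyset$ and every point $X'\in V$ with $X\subsetneq X'$ satisfies $X'\cap Y\neq\emptyset$. $X$ is recursively discriminable if it has a recursively enumerable discriminator. Enumeration reducibility: $A\le_e B$ means there is a computable $f: I\times\mathbb{N}\to P_f(I)\cup\{\{\bot\}\}$ (with $P_f(I)$ a recursive encoding of finite subsets of $I$, $\bot\notin I$) such that for all $x$: $x\in A\iff\exists n,\ f(x,n)\subseteq B$. -}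

module Defs where

open import Data.Nat using (ℕ)
open import Data.List using (List)
open import Data.List.Relation.Unary.All using (All)
open import Data.Maybe using (Maybe; just; nothing)
open import Data.Product using (Σ; ∃; _×_; _,_)
open import Relation.Binary.PropositionalEquality using (_≡_)
open import Relation.Nullary using (¬_)
open import Function.Bundles using (_⇔_)
open import Data.Empty using (⊥)

-- Synthetic computability: I = ℕ; subsets of I are predicates ℕ → Set;
-- computable functions are Agda functions (all of which are computable).

Subset : Set₁
Subset = ℕ → Set

-- a finite nonempty sequence (n₀, n₁, …, n_k) : head n₀, tail [n₁,…,n_k]
Seq : Set
Seq = ℕ × List ℕ

IsRE : {T : Set} → (T → Set) → Set
IsRE {T} A = Σ (ℕ → Maybe T) λ e → ∀ t → A t ⇔ ∃ λ n → e n ≡ just t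

-- membership of X in the quasivariety V given by the set S of sequences
InV : (Seq → Set) → Subset → Set
InV S X = ∀ n₀ ns → S (n₀ , ns) → All X ns → X n₀

_⊆_ : Subset → Subset → Set
X ⊆ Y = ∀ n → X n → Y n

_⊊_ : Subset → Subset → Set
X ⊊ X' = (X ⊆ X') × ∃ λ z → X' z × ¬ X z

Disjoint : Subset → Subset → Set
Disjoint X Y = ∀ n → X n → Y n → ⊥

Meets : Subset → Subset → Set
Meets X Y = ∃ λ n → X n × Y n

IsDiscriminator : (Seq → Set) → Subset → Subset → Set₁
IsDiscriminator S X Y =
  Disjoint Y X × (∀ (X' : Subset) → InV S X' → X ⊊ X' → Meets X' Y)

RecursivelyDiscriminable : (Seq → Set) → Subset → Set₁
RecursivelyDiscriminable S X = Σ Subset λ Y → IsRE Y × IsDiscriminator S X Y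

∁ : Subset → Subset
∁ X n = ¬ X n

-- enumeration reducibility A ≤ₑ B: a computable f : I × ℕ → P_f(I) ∪ {{⊥}}
-- (finite sets coded as lists, {⊥} coded as nothing) with
-- x ∈ A ⇔ ∃ n, f(x,n) ⊆ B   ({⊥} ⊆ B never holds since ⊥ ∉ I).
_≤ₑ_ : Subset → Subset → Set
A ≤ₑ B = Σ (ℕ → ℕ → Maybe (List ℕ)) λ f →
  ∀ x → A x ⇔ ∃ λ n → ∃ λ D → f x n ≡ just D × All B D

-- The closure of X ∪ {x} under the rules of V is a point strictly above X
-- when x ∉ X, so it meets the discriminator Y at some y, and y has a finite
-- derivation from x together with finitely many hypotheses D ⊆ X.  Conversely,
-- if x ∈ X then everything derivable from x and hypotheses D ⊆ X lies in X,
-- hence never in Y.  So x ∉ X iff some finite D ⊆ X derives, together with x,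
-- an element of Y; since S and Y are enumerable and derivations are finite
-- objects, this is an enumeration reduction of ∁ X to X.
module Submission where

open import Defs
open import Data.Nat using (ℕ; zero; suc; _+_; _≟_)
open import Data.Nat.Properties using (+-suc; +-identityʳ)
open import Data.List using (List; []; _∷_; _++_; length; foldl; map; catMaybes; mapMaybe)
open import Data.List.Properties using (foldl-++; map-++; catMaybes-++)
open import Data.List.Relation.Unary.All as All using (All; []; _∷_; all?)
open import Data.List.Relation.Unary.All.Properties using (++⁺)
open import Data.List.Relation.Unary.Any using (here; there)
open import Data.List.Membership.Propositional using (_∈_)
open import Data.List.Membership.DecPropositional _≟_ using (_∈?_)
open import Data.List.Relation.Binary.Subset.Propositional using () renaming (_⊆_ to _⊆ˡ_)
open import Data.Maybe using (Maybe; just; nothing)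
open import Data.Product using (∃; _×_; _,_; proj₁; proj₂; uncurry)
open import Data.Sum using (_⊎_; inj₁; inj₂)
open import Data.Empty using (⊥-elim)
open import Function using (_∘_)
open import Function.Bundles using (mk⇔; Equivalence)
open import Function.Definitions using (StrictlySurjective)
open import Relation.Nullary using (yes; no)
open import Relation.Binary.PropositionalEquality using (_≡_; refl; sym; trans; cong; subst)

open Equivalence using (to; from)

-- Cantor's enumeration of ℕ × ℕ along the antidiagonals a + b = const.

nextPair : ℕ × ℕ → ℕ × ℕ
nextPair (a , zero)  = zero , suc a
nextPair (a , suc b) = suc a , b

unpair : ℕ → ℕ × ℕ
unpair zero    = zero , zero
unpair (suc n) = nextPair (unpair n)

private
  Enumerated : ℕ × ℕ → Set
  Enumerated p = ∃ λ n → unpair n ≡ p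

  enumerated-next : ∀ {p} → Enumerated p → Enumerated (nextPair p)
  enumerated-next (n , refl) = suc n , refl

  enumerated-along : ∀ a b → Enumerated (zero , a + b) → Enumerated (a , b)
  enumerated-along zero    b h = h
  enumerated-along (suc a) b h =
    enumerated-next (enumerated-along a (suc b) (subst (Enumerated ∘ (zero ,_)) (sym (+-suc a b)) h))

  enumerated-axis : ∀ s → Enumerated (zero , s)
  enumerated-axis zero    = zero , refl
  enumerated-axis (suc s) =
    enumerated-next (enumerated-along s zero (subst (Enumerated ∘ (zero ,_)) (sym (+-identityʳ s)) (enumerated-axis s)))

unpair-strictlySurjective : StrictlySurjective _≡_ unpair
unpair-strictlySurjective (a , b) = enumerated-along a b (enumerated-axis (a + b))

module _ {A : Set} (decode : ℕ → A) where

  decodeListOfLength : ℕ → ℕ → List A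
  decodeListOfLength zero    _ = []
  decodeListOfLength (suc l) n = consDecoded (unpair n)
    where
    consDecoded : ℕ × ℕ → List A
    consDecoded (i , m) = decode i ∷ decodeListOfLength l m

  decodeList : ℕ → List A
  decodeList = uncurry decodeListOfLength ∘ unpair

  module _ (decode-surjective : StrictlySurjective _≡_ decode) where

    decodeListOfLength-surjective : ∀ xs → ∃ λ n → decodeListOfLength (length xs) n ≡ xs
    decodeListOfLength-surjective []       = zero , refl
    decodeListOfLength-surjective (x ∷ xs) with decode-surjective x | decodeListOfLength-surjective xs
    ... | i , refl | m , decoded with unpair-strictlySurjective (i , m)
    ... | n , unpair-n =
      n , trans (cong (λ p → decode (proj₁ p) ∷ decodeListOfLength (length xs) (proj₂ p)) unpair-n)
                (cong (decode i ∷_) decoded)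

    decodeList-strictlySurjective : StrictlySurjective _≡_ decodeList
    decodeList-strictlySurjective xs with decodeListOfLength-surjective xs
    ... | m , decoded with unpair-strictlySurjective (length xs , m)
    ... | n , unpair-n = n , trans (cong (uncurry decodeListOfLength) unpair-n) decoded

data Step : Set where
  hyp  : ℕ → Step
  rule : ℕ → Step

stepOfPair : ℕ × ℕ → Step
stepOfPair (zero  , n) = hyp n
stepOfPair (suc _ , m) = rule m

decodeStep : ℕ → Step
decodeStep = stepOfPair ∘ unpair

decodeStep-strictlySurjective : StrictlySurjective _≡_ decodeStep
decodeStep-strictlySurjective (hyp n) with unpair-strictlySurjective (zero , n)
... | k , unpair-k = k , cong stepOfPair unpair-k
decodeStep-strictlySurjective (rule m) with unpair-strictlySurjective (suc zero , m)
... | k , unpair-k = k , cong stepOfPair unpair-k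

hypothesis : Step → Maybe ℕ
hypothesis (hyp n)  = just n
hypothesis (rule _) = nothing

hypotheses : List Step → List ℕ
hypotheses = mapMaybe hypothesis

hypotheses-++ : ∀ ss ts → hypotheses (ss ++ ts) ≡ hypotheses ss ++ hypotheses ts
hypotheses-++ ss ts =
  trans (cong catMaybes (map-++ hypothesis ss ts)) (catMaybes-++ (map hypothesis ss) _)

hypotheses-++⁺ : ∀ {H : Subset} ss ts → All H (hypotheses ss) → All H (hypotheses ts) →
                 All H (hypotheses (ss ++ ts))
hypotheses-++⁺ {H} ss ts hs hts = subst (All H) (sym (hypotheses-++ ss ts)) (++⁺ hs hts)

_∪ˡ_ : List ℕ → Subset → Subset
(L ∪ˡ H) n = n ∈ L ⊎ H n

data Closure (S : Seq → Set) (A : Subset) : Subset where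
  base  : ∀ {n} → A n → Closure S A n
  close : ∀ {n₀ ns} → S (n₀ , ns) → All (Closure S A) ns → Closure S A n₀

closure-InV : ∀ S A → InV S (Closure S A)
closure-InV S A n₀ ns s cs = close s cs

closure-⊋ : ∀ S {X x} → ∁ X x → X ⊊ Closure S ((x ∷ []) ∪ˡ X)
closure-⊋ S ¬X-x = (λ _ → base ∘ inj₂) , _ , base (inj₁ (here refl)) , ¬X-x

module Derivations (e : ℕ → Maybe Seq) where

  -- A rule whose premises are not all derived yet is skipped, so every list of
  -- steps is a (possibly wasteful) derivation.
  applyRule : Maybe Seq → List ℕ → List ℕ
  applyRule nothing          L = L
  applyRule (just (n₀ , ns)) L with all? (_∈? L) ns
  ... | yes _ = n₀ ∷ L
  ... | no  _ = L

  perform : List ℕ → Step → List ℕ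
  perform L (hyp n)  = n ∷ L
  perform L (rule m) = applyRule (e m) L

  run : List ℕ → List Step → List ℕ
  run = foldl perform

  run-++ : ∀ L ss ts → run L (ss ++ ts) ≡ run (run L ss) ts
  run-++ = foldl-++ perform

  applyRule-extends : ∀ r L → L ⊆ˡ applyRule r L
  applyRule-extends nothing          L z∈L = z∈L
  applyRule-extends (just (n₀ , ns)) L z∈L with all? (_∈? L) ns
  ... | yes _ = there z∈L
  ... | no  _ = z∈L

  run-extends : ∀ L ss → L ⊆ˡ run L ss
  run-extends L []             z∈L = z∈L
  run-extends L (hyp n  ∷ ss)  z∈L = run-extends (n ∷ L) ss (there z∈L)
  run-extends L (rule m ∷ ss)  z∈L = run-extends _ ss (applyRule-extends (e m) L z∈L)

  applyRule-fires : ∀ {n₀ ns L} → All (_∈ L) ns → n₀ ∈ applyRule (just (n₀ , ns)) L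
  applyRule-fires {n₀} {ns} {L} premises with all? (_∈? L) ns
  ... | yes _          = here refl
  ... | no  ¬premises = ⊥-elim (¬premises premises)

  run-rule-fires : ∀ {m n₀ ns} L ss → e m ≡ just (n₀ , ns) → All (_∈ run L ss) ns →
                   n₀ ∈ run L (ss ++ rule m ∷ [])
  run-rule-fires {m} {n₀} L ss e-m premises rewrite run-++ L ss (rule m ∷ []) | e-m =
    applyRule-fires premises

  module _ {S : Seq → Set} (rules-sound : ∀ m {s} → e m ≡ just s → S s)
           {X : Subset} (X∈V : InV S X) where

    applyRule-preserves : ∀ {L} r → (∀ {s} → r ≡ just s → S s) → All X L → All X (applyRule r L)
    applyRule-preserves nothing          _    X-L = X-L
    applyRule-preserves {L} (just (n₀ , ns)) r∈S X-L with all? (_∈? L) ns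
    ... | yes premises = X∈V n₀ ns (r∈S refl) (All.map (All.lookup X-L) premises) ∷ X-L
    ... | no  _        = X-L

    run-preserves : ∀ L ss → All X L → All X (hypotheses ss) → All X (run L ss)
    run-preserves L []            X-L _             = X-L
    run-preserves L (hyp n  ∷ ss) X-L (X-n ∷ X-hyps) = run-preserves (n ∷ L) ss (X-n ∷ X-L) X-hyps
    run-preserves L (rule m ∷ ss) X-L X-hyps =
      run-preserves _ ss (applyRule-preserves (e m) (rules-sound m) X-L) X-hyps

  module _ {S : Seq → Set} (rules-complete : ∀ {s} → S s → ∃ λ m → e m ≡ just s)
           (L₀ : List ℕ) (H : Subset) where

    Derivable : (List ℕ → Set) → Set
    Derivable P = ∃ λ ss → All H (hypotheses ss) × ∀ L → L₀ ⊆ˡ L → P (run L ss)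

    mutual
      closure⇒derivable : ∀ {y} → Closure S (L₀ ∪ˡ H) y → Derivable (y ∈_)
      closure⇒derivable (base (inj₁ y∈L₀)) = [] , [] , λ L L₀⊆L → L₀⊆L y∈L₀
      closure⇒derivable {y} (base (inj₂ H-y)) = hyp y ∷ [] , H-y ∷ [] , λ L _ → here refl
      closure⇒derivable (close s premises) with rules-complete s | closure⇒derivableAll premises
      ... | m , e-m | ss , H-ss , derived =
        ss ++ rule m ∷ [] , hypotheses-++⁺ ss _ H-ss [] ,
        λ L L₀⊆L → run-rule-fires L ss e-m (derived L L₀⊆L)

      closure⇒derivableAll : ∀ {ys} → All (Closure S (L₀ ∪ˡ H)) ys →
                             Derivable (λ K → All (_∈ K) ys)
      closure⇒derivableAll [] = [] , [] , λ _ _ → []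
      closure⇒derivableAll (c ∷ cs) with closure⇒derivable c | closure⇒derivableAll cs
      ... | ss , H-ss , derived | ts , H-ts , derivedAll =
        ss ++ ts , hypotheses-++⁺ ss ts H-ss H-ts , λ L L₀⊆L →
          subst (λ K → All (_∈ K) _) (sym (run-++ L ss ts))
            (run-extends _ ts (derived L L₀⊆L) ∷ derivedAll (run L ss) (run-extends L ss ∘ L₀⊆L))

  verdict : List ℕ → Maybe ℕ → List Step → Maybe (List ℕ)
  verdict L₀ nothing  ss = nothing
  verdict L₀ (just y) ss with y ∈? run L₀ ss
  ... | yes _ = just (hypotheses ss)
  ... | no  _ = nothing

  verdict-just : ∀ L₀ t ss {D} → verdict L₀ t ss ≡ just D →
                 ∃ λ y → t ≡ just y × y ∈ run L₀ ss × hypotheses ss ≡ D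
  verdict-just L₀ (just y) ss eq with y ∈? run L₀ ss
  verdict-just L₀ (just y) ss refl | yes y∈run = y , refl , y∈run , refl

  verdict-accepts : ∀ {L₀ y} ss → y ∈ run L₀ ss → verdict L₀ (just y) ss ≡ just (hypotheses ss)
  verdict-accepts {L₀} {y} ss y∈run with y ∈? run L₀ ss
  ... | yes _     = refl
  ... | no  y∉run = ⊥-elim (y∉run y∈run)

-- The reduction of ∁ X to X: the input n codes an index k into the enumeration
-- eY of the discriminator together with a derivation; it is accepted when the
-- derivation, started from x, reaches eY k, and then asks for its hypotheses.
complementReduction : (ℕ → Maybe Seq) → (ℕ → Maybe ℕ) → ℕ → ℕ → Maybe (List ℕ)
complementReduction e eY x = certify ∘ unpair
  where
  certify : ℕ × ℕ → Maybe (List ℕ)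
  certify (k , c) = Derivations.verdict e (x ∷ []) (eY k) (decodeList decodeStep c)

module _ {S : Seq → Set} {e : ℕ → Maybe Seq} {X Y : Subset} {eY : ℕ → Maybe ℕ}
         (Y∩X≡∅ : Disjoint Y X) where
  open Derivations e

  complementReduction-sound : (∀ m {s} → e m ≡ just s → S s) → InV S X →
                              (∀ k {y} → eY k ≡ just y → Y y) →
                              ∀ x n {D} → complementReduction e eY x n ≡ just D → All X D → ∁ X x
  complementReduction-sound rules-sound X∈V eY-sound x n accepted X-D X-x with unpair n
  ... | k , c with verdict-just (x ∷ []) (eY k) (decodeList decodeStep c) accepted
  ... | y , eY-k , y∈run , refl =
    Y∩X≡∅ y (eY-sound k eY-k)
      (All.lookup (run-preserves rules-sound X∈V (x ∷ []) (decodeList decodeStep c) (X-x ∷ []) X-D) y∈run)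

  complementReduction-complete : (∀ {s} → S s → ∃ λ m → e m ≡ just s) →
                                 (∀ {y} → Y y → ∃ λ k → eY k ≡ just y) →
                                 (∀ X' → InV S X' → X ⊊ X' → Meets X' Y) →
                                 ∀ x → ∁ X x → ∃ λ n → ∃ λ D → complementReduction e eY x n ≡ just D × All X D
  complementReduction-complete rules-complete eY-complete discriminates x ¬X-x
    with discriminates (Closure S ((x ∷ []) ∪ˡ X)) (closure-InV S _) (closure-⊋ S ¬X-x)
  ... | y , closure-y , Y-y
    with closure⇒derivable rules-complete (x ∷ []) X closure-y | eY-complete Y-y
  ... | ss , X-hyps , derived | k , eY-k
    with decodeList-strictlySurjective decodeStep decodeStep-strictlySurjective ss
  ... | c , decode-c with unpair-strictlySurjective (k , c)
  ... | n , unpair-n = n , hypotheses ss , accepted , X-hyps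
    where
    accepted : complementReduction e eY x n ≡ just (hypotheses ss)
    accepted rewrite unpair-n | eY-k | decode-c = verdict-accepts ss (derived (x ∷ []) (λ z∈ → z∈))

mainTheorem9 : (S : Seq → Set) → IsRE S → (X : Subset) → InV S X →
               RecursivelyDiscriminable S X → ∁ X ≤ₑ X
mainTheorem9 S (e , e-enumerates) X X∈V (Y , (eY , eY-enumerates) , Y∩X≡∅ , discriminates) =
  complementReduction e eY , λ x → mk⇔
    (complementReduction-complete Y∩X≡∅ (to (e-enumerates _)) (to (eY-enumerates _)) discriminates x)
    (λ (n , D , accepted , X-D) →
       complementReduction-sound Y∩X≡∅ (λ m e-m → from (e-enumerates _) (m , e-m))
         X∈V (λ k eY-k → from (eY-enumerates _) (k , eY-k)) x n accepted X-D)
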